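{- Let $n,r\in\mathbb{N}$ and let $\mathcal{A}$ be any family of $r$-element subsets of $[n]=\{1,\dots,n\}$. Then \[ e(\mathcal{A})\ge \frac{\ell(\mathcal{A})^2}{2\binom{2r}{r}}. \]
   Context: For a family $\mathcal{A}$ of $r$-element subsets of $[n]$, $e(\mathcal{A})$ denotes the number of (unordered) pairs of disjoint sets in $\mathcal{A}$; equivalently, the number of edges in the subgraph induced by $\mathcal{A}$ in the Kneser graph $K(n,r)$ (the graph on the $r$-element subsets of $[n]$ in which two sets are adjacent if and only if they are disjoint). A family is intersecting if any two of its members have nonempty intersection. $\ell(\mathcal{A})=|\mathcal{A}|-|\mathcal{A}^*|$, where $\mathcal{A}^*$ is an intersecting subfamily of $\mathcal{A}$ of maximum cardinality. -}

module Defs where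

open import Data.Bool.Properties using () renaming (_≟_ to _≟ᵇ_)
open import Data.Fin.Subset using (Subset; Nonempty; Empty; _∩_; ∣_∣)
open import Data.Fin.Subset.Properties using (nonempty?)
open import Data.List using (List; []; _∷_; [_]; _++_; map; filter; length)
open import Data.List.Extrema.Nat using (argmax; argmax-all; f[xs]≤f[argmax])
open import Data.List.Membership.Propositional using (_∈_)
open import Data.List.Membership.Propositional.Properties
  using (∈-∃++; ∈-++⁻; ∈-++⁺ˡ; ∈-++⁺ʳ; ∈-map⁺; ∈-map⁻; ∈-filter⁺; ∈-filter⁻)
import Data.List.Membership.DecPropositional as DecMembership
open import Data.List.Properties using (length-++)
open import Data.List.Relation.Binary.Sublist.Propositional
  using ([]; _∷ʳ_; _∷_) renaming (_⊆_ to _⊑_; lookup to ⊑-lookup; minimum to []⊑_)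
open import Data.List.Relation.Binary.Sublist.Propositional.Properties
  using (All-resp-⊆)
open import Data.List.Relation.Binary.Subset.Propositional using (_⊆_)
open import Data.List.Relation.Unary.All using (All; []; _∷_; all?)
import Data.List.Relation.Unary.All as All
open import Data.List.Relation.Unary.AllPairs using ([]; _∷_)
open import Data.List.Relation.Unary.Any using (here; there)
open import Data.List.Relation.Unary.Unique.Propositional using (Unique)
open import Data.Nat using (ℕ; zero; suc; _+_; _*_; _∸_; _≤_; _<_; z≤n; s≤s; NonZero; >-nonZero)
open import Data.Nat.Combinatorics using (_C_; nCk+nC[k+1]≡[n+1]C[k+1])
open import Data.Nat.Properties using (+-suc; ≤-trans; m≤m+n; m*n≢0; module ≤-Reasoning)
open import Data.Product using (∃; _×_; _,_; proj₁; proj₂)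
open import Data.Sum using (inj₁; inj₂)
open import Data.Vec.Properties using (≡-dec)
open import Level using (0ℓ)
open import Relation.Binary using (DecidableEquality)
open import Relation.Binary.PropositionalEquality using (_≡_; _≢_; refl; cong; subst)
open import Relation.Nullary using (yes; no; contradiction)
open import Relation.Nullary.Decidable using (¬?; _→-dec_)
open import Relation.Unary using (Pred; Decidable)

-- A set of r-element subsets of [n], listed without repetition in an
-- arbitrary order; Fin n plays the role of [n] = {1, …, n}.
record Family (n r : ℕ) : Set where
  field
    members : List (Subset n)
    unique  : Unique members
    uniform : All (λ S → ∣ S ∣ ≡ r) members

open Family public

module _ {n r : ℕ} where

  card : Family n r → ℕ
  card 𝓐 = length (members 𝓐)

  _⊆ᶠ_ : Family n r → Family n r → Set
  𝓑 ⊆ᶠ 𝓐 = members 𝓑 ⊆ members 𝓐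

  -- "Any two members" means two distinct members, so that an intersecting
  -- family is an independent set of the Kneser graph.  For r ≥ 1 the
  -- condition S ≢ T makes no difference, since S ∩ S = S is then nonempty.
  Intersecting : Family n r → Set
  Intersecting 𝓐 = ∀ {S T} → S ∈ members 𝓐 → T ∈ members 𝓐 → S ≢ T → Nonempty (S ∩ T)

  record IsMaximumIntersecting (𝓐 𝓐* : Family n r) : Set where
    field
      subfamily    : 𝓐* ⊆ᶠ 𝓐
      intersecting : Intersecting 𝓐*
      maximum      : ∀ 𝓑 → 𝓑 ⊆ᶠ 𝓐 → Intersecting 𝓑 → card 𝓑 ≤ card 𝓐*

Disjoint : ∀ {n} → Subset n × Subset n → Set
Disjoint (S , T) = Empty (S ∩ T)

disjoint? : ∀ {n} → Decidable (Disjoint {n})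
disjoint? (S , T) = ¬? (nonempty? (S ∩ T))

-- All (xᵢ , xⱼ) with i < j: for a list without repetitions, each unordered
-- pair of distinct entries occurs exactly once.
pairs : ∀ {A : Set} → List A → List (A × A)
pairs []       = []
pairs (x ∷ xs) = map (x ,_) xs ++ pairs xs

e : ∀ {n r} → Family n r → ℕ
e 𝓐 = length (filter disjoint? (pairs (members 𝓐)))

unique-⊆⇒length-≤ : ∀ {A : Set} {xs ys : List A} → Unique xs → xs ⊆ ys → length xs ≤ length ys
unique-⊆⇒length-≤ []            _  = z≤n
unique-⊆⇒length-≤ {xs = x ∷ xs} (x∉ ∷ uxs) xs⊆ with ∈-∃++ (xs⊆ (here refl))
... | us , vs , refl = begin
  suc (length xs)             ≤⟨ s≤s (unique-⊆⇒length-≤ uxs xs⊆us++vs) ⟩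
  suc (length (us ++ vs))     ≡⟨ cong suc (length-++ us) ⟩
  suc (length us + length vs) ≡⟨ +-suc (length us) (length vs) ⟨
  length us + suc (length vs) ≡⟨ length-++ us ⟨
  length (us ++ x ∷ vs)       ∎
  where
  open ≤-Reasoning
  xs⊆us++vs : xs ⊆ us ++ vs
  xs⊆us++vs y∈ with ∈-++⁻ us (xs⊆ (there y∈))
  ... | inj₁ y∈us         = ∈-++⁺ˡ y∈us
  ... | inj₂ (here refl)  = contradiction refl (All.lookup x∉ y∈)
  ... | inj₂ (there y∈vs) = ∈-++⁺ʳ us y∈vs

private
  module _ {A : Set} where

    sublists : List A → List (List A)
    sublists []       = [ [] ]
    sublists (x ∷ xs) = map (x ∷_) (sublists xs) ++ sublists xs

    sublists-sound : ∀ xs {ys : List A} → ys ∈ sublists xs → ys ⊑ xs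
    sublists-sound []       (here refl) = []
    sublists-sound (x ∷ xs) ys∈ with ∈-++⁻ (map (x ∷_) (sublists xs)) ys∈
    ... | inj₂ ys∈xs = x ∷ʳ sublists-sound xs ys∈xs
    ... | inj₁ ys∈x∷ with ∈-map⁻ (x ∷_) ys∈x∷
    ...   | _ , zs∈ , refl = refl ∷ sublists-sound xs zs∈

    filter∈sublists : ∀ {P : Pred A 0ℓ} (P? : Decidable P) xs → filter P? xs ∈ sublists xs
    filter∈sublists P? []       = here refl
    filter∈sublists P? (x ∷ xs) with P? x
    ... | yes _ = ∈-++⁺ˡ (∈-map⁺ (x ∷_) (filter∈sublists P? xs))
    ... | no  _ = ∈-++⁺ʳ (map (x ∷_) (sublists xs)) (filter∈sublists P? xs)

    unique-resp-⊑ : ∀ {xs ys : List A} → xs ⊑ ys → Unique ys → Unique xs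
    unique-resp-⊑ []         []       = []
    unique-resp-⊑ (_ ∷ʳ p)   (_ ∷ us) = unique-resp-⊑ p us
    unique-resp-⊑ (refl ∷ p) (u ∷ us) = All-resp-⊆ p u ∷ unique-resp-⊑ p us

  _≟ˢ_ : ∀ {n} → DecidableEquality (Subset n)
  _≟ˢ_ = ≡-dec _≟ᵇ_

  Meet : ∀ {n} → List (Subset n) → Set
  Meet xs = All (λ S → All (λ T → S ≢ T → Nonempty (S ∩ T)) xs) xs

  meet? : ∀ {n} → Decidable (Meet {n})
  meet? xs = all? (λ S → all? (λ T → ¬? (S ≟ˢ T) →-dec nonempty? (S ∩ T)) xs) xs

maximumIntersecting : ∀ {n r} (𝓐 : Family n r) → ∃ (IsMaximumIntersecting 𝓐)
maximumIntersecting {n} {r} 𝓐 = 𝓐* , record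
  { subfamily    = ⊑-lookup best⊑
  ; intersecting = λ S∈ T∈ → All.lookup (All.lookup best-meet S∈) T∈
  ; maximum      = maximum
  }
  where
  open DecMembership (_≟ˢ_ {n}) using (_∈?_)
  xs         = members 𝓐
  candidates = filter meet? (sublists xs)
  best       = argmax length [] candidates

  best-good : best ⊑ xs × Meet best
  best-good = argmax-all length (([]⊑ xs) , []) (All.tabulate λ ys∈ →
    let ys∈′ , meet = ∈-filter⁻ meet? {xs = sublists xs} ys∈ in sublists-sound xs ys∈′ , meet)

  best⊑     = proj₁ best-good
  best-meet = proj₂ best-good

  𝓐* : Family n r
  𝓐* = record
    { members = best
    ; unique  = unique-resp-⊑ best⊑ (unique 𝓐)
    ; uniform = All-resp-⊆ best⊑ (uniform 𝓐)
    }

  maximum : ∀ 𝓑 → 𝓑 ⊆ᶠ 𝓐 → Intersecting 𝓑 → card 𝓑 ≤ card 𝓐*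
  maximum 𝓑 𝓑⊆𝓐 int = ≤-trans
    (unique-⊆⇒length-≤ (unique 𝓑) (λ S∈ → ∈-filter⁺ (_∈? members 𝓑) (𝓑⊆𝓐 S∈) S∈))
    (All.lookup (f[xs]≤f[argmax] {f = length} [] candidates)
      (∈-filter⁺ meet? (filter∈sublists (_∈? members 𝓑) xs)
        (All.tabulate λ S∈ → All.tabulate λ T∈ → int (back S∈) (back T∈))))
    where
    back : ∀ {S} → S ∈ filter (_∈? members 𝓑) xs → S ∈ members 𝓑
    back S∈ = proj₂ (∈-filter⁻ (_∈? members 𝓑) {xs = xs} S∈)

-- Truncated subtraction is harmless: 𝓐* is a subfamily of 𝓐.
ℓ : ∀ {n r} → Family n r → ℕ
ℓ 𝓐 = card 𝓐 ∸ card 𝓐*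
  where 𝓐* = proj₁ (maximumIntersecting 𝓐)

nCk>0 : ∀ {n k} → k ≤ n → 0 < n C k
nCk>0 {k = zero} _ = s≤s z≤n
nCk>0 {suc n} {suc k} (s≤s k≤n) = subst (0 <_) (nCk+nC[k+1]≡[n+1]C[k+1] n k)
  (≤-trans (nCk>0 k≤n) (m≤m+n (n C k) (n C suc k)))

2*[2r]Cr≢0 : ∀ r → NonZero (2 * ((2 * r) C r))
2*[2r]Cr≢0 r = m*n≢0 2 ((2 * r) C r) {{_}} {{>-nonZero (nCk>0 (m≤m+n r (r + 0)))}}

{-# OPTIONS --safe #-}
module Submission where

-- Let N = C(2r, r) and suppose that at least k members must be deleted from 𝓐 to
-- leave an intersecting family.  The neighbourhoods of the vertices of a maximal
-- induced matching of the Kneser graph of 𝓐 cover all its edges, and listing the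
-- matching in both orientations gives a Bollobás system of set pairs, so these
-- vertices number at most N.  Hence some member has degree at least k / N.
-- Deleting it and repeating yields e(𝓐) ≥ (k + (k - 1) + … + 1) / N ≥ k² / 2N.
-- Bollobás' inequality is proved by averaging over the deletion of one point of
-- the ground set, dropping the pairs (A , B) whose A contains the deleted point.

open import Defs
open import Algebra.Properties.CommutativeSemigroup using (x∙yz≈y∙xz; interchange)
open import Data.Bool using (if_then_else_)
open import Data.Fin using (Fin; zero; suc)
open import Data.Fin.Subset using (Subset; Nonempty; Empty; _∩_; ∣_∣; inside; outside; ⁅_⁆) renaming (_∈_ to _∈ˢ_; _∉_ to _∉ˢ_)
open import Data.Fin.Subset.Properties using (nonempty?; Empty-unique; ∣⊥∣≡0; ∣⁅x⁆∣≡1; p⊆q⇒∣p∣≤∣q∣; x∈p∩q⁺; x∈p∩q⁻; x∈⁅y⁆⇒x≡y; drop-there; ∩-comm) renaming (_∈?_ to _∈ˢ?_)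
import Data.Integer as ℤ
import Data.Integer.Properties as ℤ
open import Data.List using (List; []; _∷_; _++_; map; filter; length; allFin; tabulate)
open import Data.List.Membership.Propositional using (_∈_; find; lose)
open import Data.List.Membership.Propositional.Properties using (∈-∃++; ∈-allFin; ∈-filter⁻)
open import Data.List.Properties using (length-map; length-++; filter-++; map-∘; length-filter; filter-notAll)
open import Data.List.Relation.Binary.Permutation.Propositional using (_↭_; refl; prep; swap; trans; ↭⇒↭ₛ; ↭-sym; ↭-refl)
open import Data.List.Relation.Binary.Permutation.Propositional.Properties using (filter-↭; ↭-length; ∈-resp-↭; All-resp-↭; shift)
import Data.List.Relation.Binary.Permutation.Setoid.Properties as ↭ₛ
open import Data.List.Relation.Binary.Sublist.Propositional.Properties using (filter-⊆; filter⁺; length-mono-≤)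
open import Data.List.Relation.Binary.Subset.Propositional using (_⊆_)
open import Data.List.Relation.Unary.All using (All; []; _∷_)
import Data.List.Relation.Unary.All as All
import Data.List.Relation.Unary.All.Properties as All
open import Data.List.Relation.Unary.AllPairs using (AllPairs; []; _∷_)
import Data.List.Relation.Unary.AllPairs as AllPairs
import Data.List.Relation.Unary.AllPairs.Properties as AllPairs
open import Data.List.Relation.Unary.Any using (here; there; any?)
open import Data.List.Relation.Unary.Unique.Propositional using (Unique)
open import Data.Nat using (ℕ; zero; suc; _+_; _*_; _∸_; _^_; _!; _≤_; _<_; _≤?_; z≤n; s≤s; NonZero; >-nonZero)
open import Data.Nat.Combinatorics using (_C_; nCk≡n!/k![n-k]!; k![n∸k]!∣n!)
open import Data.Nat.DivMod using (m/n*n≡m)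
open import Data.Nat.ListAction using (sum)
open import Data.Nat.Properties
open import Data.Nat.Tactic.RingSolver using (solve-∀)
open import Data.Product using (∃-syntax; _×_; _,_; proj₁; proj₂; map₂)
import Data.Rational as ℚ
open import Data.Rational using (_/_; _≥_)
import Data.Rational.Properties as ℚ
import Data.Rational.Unnormalised as ℚᵘ
import Data.Rational.Unnormalised.Properties as ℚᵘ
open import Data.Sum using (_⊎_; inj₁; inj₂)
open import Data.Vec using ([]; _∷_)
import Data.Vec as Vec
open import Function using (_∘_)
open import Level using (0ℓ)
open import Relation.Binary using (Symmetric) renaming (Decidable to Decidable₂)
open import Relation.Binary.PropositionalEquality using (_≡_; refl; sym; cong; cong₂; subst; module ≡-Reasoning)
import Relation.Binary.PropositionalEquality as ≡
open import Relation.Nullary using (¬_; yes; no; does; contradiction)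
open import Relation.Nullary.Decidable using (¬?; decidable-stable)
open import Relation.Unary using (Pred; Decidable)

private variable
  A B : Set

-- Finite sums and counts over lists.

∑ : (A → ℕ) → List A → ℕ
∑ f xs = sum (map f xs)

∑-mono : ∀ {f g : A → ℕ} {xs} → All (λ x → f x ≤ g x) xs → ∑ f xs ≤ ∑ g xs
∑-mono []       = z≤n
∑-mono (p ∷ ps) = +-mono-≤ p (∑-mono ps)

∑-const : ∀ c (xs : List A) → ∑ (λ _ → c) xs ≡ length xs * c
∑-const c []       = refl
∑-const c (x ∷ xs) = cong (c +_) (∑-const c xs)

∑-*ˡ : ∀ c (f : A → ℕ) xs → ∑ (λ x → c * f x) xs ≡ c * ∑ f xs
∑-*ˡ c f []       = sym (*-zeroʳ c)
∑-*ˡ c f (x ∷ xs) rewrite ∑-*ˡ c f xs = sym (*-distribˡ-+ c (f x) (∑ f xs))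

∑-+ : ∀ (f g : A → ℕ) xs → ∑ (λ x → f x + g x) xs ≡ ∑ f xs + ∑ g xs
∑-+ f g []       = refl
∑-+ f g (x ∷ xs) rewrite ∑-+ f g xs = interchange +-commutativeSemigroup (f x) (g x) (∑ f xs) (∑ g xs)

∑-swap : ∀ (f : A → B → ℕ) xs ys → ∑ (λ x → ∑ (f x) ys) xs ≡ ∑ (λ y → ∑ (λ x → f x y) xs) ys
∑-swap f []       ys = sym (≡.trans (∑-const 0 ys) (*-zeroʳ (length ys)))
∑-swap f (x ∷ xs) ys rewrite ∑-swap f xs ys = sym (∑-+ (f x) (λ y → ∑ (λ x′ → f x′ y) xs) ys)

∑-filter : ∀ {P : Pred A 0ℓ} (P? : Decidable P) (f : A → ℕ) xs →
           ∑ f (filter (¬? ∘ P?) xs) ≡ ∑ (λ x → if does (P? x) then 0 else f x) xs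
∑-filter P? f []       = refl
∑-filter P? f (x ∷ xs) with P? x
... | yes _ = ∑-filter P? f xs
... | no  _ = cong (f x +_) (∑-filter P? f xs)

count : {P : Pred A 0ℓ} → Decidable P → List A → ℕ
count P? xs = length (filter P? xs)

module _ {P : Pred A 0ℓ} (P? : Decidable P) where

  count-↭ : ∀ {xs ys} → xs ↭ ys → count P? xs ≡ count P? ys
  count-↭ xs↭ys = ↭-length (filter-↭ P? xs↭ys)

  count-∁ : ∀ xs → length xs ≡ count (¬? ∘ P?) xs + count P? xs
  count-∁ []       = refl
  count-∁ (x ∷ xs) with P? x
  ... | yes _ = ≡.trans (cong suc (count-∁ xs)) (sym (+-suc _ _))
  ... | no  _ = cong suc (count-∁ xs)

  count-map : ∀ (f : B → A) xs → count P? (map f xs) ≡ count (P? ∘ f) xs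
  count-map f []       = refl
  count-map f (x ∷ xs) with P? (f x)
  ... | yes _ = cong suc (count-map f xs)
  ... | no  _ = count-map f xs

  count-filter-≤ : ∀ {Q : Pred A 0ℓ} (Q? : Decidable Q) xs → count P? (filter Q? xs) ≤ count P? xs
  count-filter-≤ Q? xs = length-mono-≤ (filter⁺ P? P? (λ { refl Px → Px }) (filter-⊆ Q? xs))

  count-tail : ∀ {x xs} → ¬ P x → count P? (x ∷ xs) ≡ count P? xs
  count-tail {x} ¬Px with P? x
  ... | yes Px = contradiction Px ¬Px
  ... | no  _  = refl

  count-head : ∀ {x xs} → P x → count P? (x ∷ xs) ≡ suc (count P? xs)
  count-head {x} Px with P? x
  ... | yes _   = refl
  ... | no  ¬Px = contradiction Px ¬Px

  count-∷-≤ : ∀ x xs → count P? xs ≤ count P? (x ∷ xs)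
  count-∷-≤ x xs with P? x
  ... | yes _ = n≤1+n _
  ... | no  _ = ≤-refl

  ∈⇒0<count : ∀ {x xs} → x ∈ xs → P x → 0 < count P? xs
  ∈⇒0<count {xs = y ∷ ys} (here refl) Px rewrite count-head {xs = ys} Px = s≤s z≤n
  ∈⇒0<count {xs = y ∷ ys} (there x∈)  Px = ≤-trans (∈⇒0<count x∈ Px) (count-∷-≤ y ys)

∈⇒↭ : ∀ {x : A} {xs} → x ∈ xs → ∃[ ys ] xs ↭ x ∷ ys
∈⇒↭ {x = x} x∈xs with ∈-∃++ x∈xs
... | us , vs , refl = us ++ vs , shift x us vs

-- One-point deletions, rising factorials and binomial coefficients.

deletions : List A → List (A × List A)
deletions []       = []
deletions (x ∷ xs) = (x , xs) ∷ map (map₂ (x ∷_)) (deletions xs)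

deletions-↭ : ∀ (xs : List A) → All (λ (y , ys) → xs ↭ y ∷ ys) (deletions xs)
deletions-↭ []       = []
deletions-↭ (x ∷ xs) = ↭-refl ∷ All.map⁺ (All.map (λ p → trans (prep x p) (swap x _ ↭-refl)) (deletions-↭ xs))

∑-deletions : ∀ (f : A → ℕ) xs → ∑ (f ∘ proj₁) (deletions xs) ≡ ∑ f xs
∑-deletions f []       = refl
∑-deletions f (x ∷ xs) = cong (f x +_) (≡.trans (cong sum (sym (map-∘ (deletions xs)))) (∑-deletions f xs))

length-deletions : ∀ (xs : List A) → length (deletions xs) ≡ length xs
length-deletions []       = refl
length-deletions (x ∷ xs) = cong suc (≡.trans (length-map _ (deletions xs)) (length-deletions xs))

-- The product (m + 1)(m + 2)...(m + k), which is (m + k)! / m! without division.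
rising : ℕ → ℕ → ℕ
rising m zero    = 1
rising m (suc k) = suc m * rising (suc m) k

!*rising : ∀ m k → m ! * rising m k ≡ (m + k) !
!*rising m zero    = ≡.trans (*-identityʳ (m !)) (cong _! (sym (+-identityʳ m)))
!*rising m (suc k) = begin
  m ! * (suc m * rising (suc m) k) ≡⟨ *-assoc (m !) (suc m) _ ⟨
  m ! * suc m * rising (suc m) k   ≡⟨ cong (_* rising (suc m) k) (*-comm (m !) (suc m)) ⟩
  suc m ! * rising (suc m) k       ≡⟨ !*rising (suc m) k ⟩
  suc (m + k) !                    ≡⟨ cong _! (+-suc m k) ⟨
  (m + suc k) !                    ∎
  where open ≡-Reasoning

C*!*! : ∀ a b → ((a + b) C a) * (a ! * b !) ≡ (a + b) !
C*!*! a b = begin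
  ((a + b) C a) * (a ! * b !)           ≡⟨ cong (λ c → ((a + b) C a) * (a ! * c !)) (m+n∸m≡n a b) ⟨
  ((a + b) C a) * (a ! * (a + b ∸ a) !) ≡⟨ cong (_* (a ! * (a + b ∸ a) !)) (nCk≡n!/k![n-k]! (m≤m+n a b)) ⟩
  _                                     ≡⟨ m/n*n≡m (k![n∸k]!∣n! (m≤m+n a b)) ⟩
  (a + b) !                             ∎
  where
  open ≡-Reasoning
  instance _ = a !* (a + b ∸ a) !≢0

-- Bollobás' inequality for set pairs.

module SetPairs (a b n : ℕ) where

  Pair : Set
  Pair = Subset n × Subset n

  -- `AllPairs` relates each entry to the later ones only, so both intersections are required here.
  Cross : Pair → Pair → Set
  Cross (A , B) (C , D) = Nonempty (A ∩ D) × Nonempty (C ∩ B)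

  -- (a+b)!/a! times 1 / C(a+j, a), the probability that in a random order of
  -- A ∪ B, with |A| = a and |B| = j ≤ b, all of A comes before all of B.
  weight : ℕ → ℕ
  weight j = j ! * rising (a + j) (b ∸ j)

  -- Reciprocal form of (j + 1) C(a + j + 1, a) = (a + j + 1) C(a + j, a). The bound j < b keeps
  -- `b ∸ j` positive.
  weight-rec : ∀ {j} → j < b → suc j * weight j ≡ (a + suc j) * weight (suc j)
  weight-rec {j} j<b rewrite +-∸-assoc 1 j<b | +-suc a j = lemma j (j !) (a + j) (rising (suc (a + j)) (b ∸ suc j))
    where
    lemma : ∀ j f m s → suc j * (f * (suc m * s)) ≡ suc m * (suc j * f * s)
    lemma = solve-∀

  weight-≤ : ∀ j → j ≤ b → weight j ≤ weight 0
  weight-≤ zero    _   = ≤-refl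
  weight-≤ (suc j) j<b = ≤-trans (*-cancelˡ-≤ (suc j) (begin
    suc j * weight (suc j)       ≤⟨ *-monoˡ-≤ (weight (suc j)) (m≤n+m (suc j) a) ⟩
    (a + suc j) * weight (suc j) ≡⟨ weight-rec j<b ⟨
    suc j * weight j             ∎)) (weight-≤ j (<⇒≤ j<b))
    where open ≤-Reasoning

  -- The ground set is a list `G` that shrinks while the sets stay in `Subset n`, so deleting a
  -- point needs no re-indexing.
  ∣_↾_∣ : Subset n → List (Fin n) → ℕ
  ∣ S ↾ G ∣ = count (_∈ˢ? S) G

  -- The invariant of the deletion process: a pair survives only the deletion of points outside A,
  -- so A stays within `G`, whereas B may lose points.
  record Admissible (G : List (Fin n)) (p : Pair) : Set where
    constructor admissible
    field
      disjoint : Disjoint p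
      A⊆G      : ∀ {x} → x ∈ˢ proj₁ p → x ∈ G
      ∣A∣≤a    : ∣ proj₁ p ↾ G ∣ ≤ a
      ∣B∣≤b    : ∣ proj₂ p ↾ G ∣ ≤ b

  open Admissible

  -- A dropped pair contributes 0 instead of leaving the list, so the list of pairs is the same for
  -- every deletion and the order of summation can be exchanged.
  termAt : Pair → Fin n × List (Fin n) → ℕ
  termAt (A , B) (y , G) = if does (y ∈ˢ? A) then 0 else weight ∣ B ↾ G ∣

  -- Let j + 1 points of B lie in `G`. By `weight-rec` they contribute (j + 1) w₀ = (a + j + 1) w₁,
  -- which makes up for the at most a + j + 1 points of A and B that do not contribute w₁. If B
  -- missed `G`, nothing would make up for the points of A; hence the positivity hypothesis.
  deletion-average : ∀ {G p} → Admissible G p → 0 < ∣ proj₂ p ↾ G ∣ →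
                     length G * weight ∣ proj₂ p ↾ G ∣ ≤ ∑ (termAt p) (deletions G)
  deletion-average {G} {p@(A , B)} adm 0<∣B∣ with ∣ B ↾ G ∣ in ∣B∣≡
  -- Adding `(a + suc j) * w₁` to both sides avoids subtraction.
  ... | suc j = +-cancelʳ-≤ ((a + suc j) * w₁) _ _ (begin
    length G * w₁ + (a + suc j) * w₁              ≡⟨ cong (λ k → length G * w₁ + k) (weight-rec j<b) ⟨
    length G * w₁ + suc j * w₀                    ≡⟨ cong (λ k → length G * w₁ + k * w₀) ∣B∣≡ ⟨
    length G * w₁ + ∣ B ↾ G ∣ * w₀                ≡⟨ balance G ⟨
    ∑ term G + (∣ A ↾ G ∣ + ∣ B ↾ G ∣) * w₁       ≡⟨ cong (λ k → ∑ term G + (∣ A ↾ G ∣ + k) * w₁) ∣B∣≡ ⟩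
    ∑ term G + (∣ A ↾ G ∣ + suc j) * w₁           ≤⟨ +-monoʳ-≤ (∑ term G) (*-monoˡ-≤ w₁ (+-monoˡ-≤ (suc j) (∣A∣≤a adm))) ⟩
    ∑ term G + (a + suc j) * w₁                   ≡⟨ cong (_+ (a + suc j) * w₁) (∑-deletions term G) ⟨
    ∑ (term ∘ proj₁) (deletions G) + (a + suc j) * w₁
      ≤⟨ +-monoˡ-≤ ((a + suc j) * w₁) (∑-mono (All.map term≤ (deletions-↭ G))) ⟩
    ∑ (termAt p) (deletions G) + (a + suc j) * w₁ ∎)
    where
    open ≤-Reasoning
    w₀ = weight j
    w₁ = weight (suc j)

    j<b : j < b
    j<b = subst (_≤ b) ∣B∣≡ (∣B∣≤b adm)

    -- The value depends on the deleted point alone, as |B| drops to j or stays j + 1; `∑-deletions`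
    -- then gives a sum over `G`.
    term : Fin n → ℕ
    term y = if does (y ∈ˢ? A) then 0 else if does (y ∈ˢ? B) then w₀ else w₁

    balance : ∀ H → ∑ term H + (∣ A ↾ H ∣ + ∣ B ↾ H ∣) * w₁ ≡ length H * w₁ + ∣ B ↾ H ∣ * w₀
    balance []      = refl
    balance (y ∷ H) with y ∈ˢ? A | y ∈ˢ? B
    ... | yes y∈A | yes y∈B = contradiction (y , x∈p∩q⁺ (y∈A , y∈B)) (disjoint adm)
    ... | yes _   | no  _   = ≡.trans (lemma (∑ term H) (∣ A ↾ H ∣ + ∣ B ↾ H ∣) w₁) (≡.trans (cong (w₁ +_) (balance H)) (sym (+-assoc w₁ _ _)))
      where
      lemma : ∀ s k w → s + suc k * w ≡ w + (s + k * w)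
      lemma = solve-∀
    ... | no _    | yes _   = ≡.trans (lemma (∑ term H) ∣ A ↾ H ∣ ∣ B ↾ H ∣ w₀ w₁)
                                (≡.trans (cong (w₀ + w₁ +_) (balance H)) (lemma′ (length H) ∣ B ↾ H ∣ w₀ w₁))
      where
      lemma : ∀ s k l w₀ w₁ → w₀ + s + (k + suc l) * w₁ ≡ w₀ + w₁ + (s + (k + l) * w₁)
      lemma = solve-∀
      lemma′ : ∀ h l w₀ w₁ → w₀ + w₁ + (h * w₁ + l * w₀) ≡ suc h * w₁ + suc l * w₀
      lemma′ = solve-∀
    ... | no _    | no  _   = ≡.trans (+-assoc w₁ _ _) (≡.trans (cong (w₁ +_) (balance H)) (sym (+-assoc w₁ _ _)))

    term≤ : ∀ {d} → G ↭ proj₁ d ∷ proj₂ d → term (proj₁ d) ≤ termAt p d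
    term≤ {y , G′} G↭ with y ∈ˢ? A
    ... | yes _ = z≤n
    ... | no  _ with y ∈ˢ? B
    ...   | yes y∈B rewrite suc-injective (≡.trans (sym (count-head (_∈ˢ? B) y∈B)) (≡.trans (sym (count-↭ (_∈ˢ? B) G↭)) ∣B∣≡)) = ≤-refl
    ...   | no  y∉B rewrite ≡.trans (sym (count-tail (_∈ˢ? B) {xs = G′} y∉B)) (≡.trans (sym (count-↭ (_∈ˢ? B) G↭)) ∣B∣≡) = ≤-refl

  admissible-delete : ∀ {G G′ y p} → G ↭ y ∷ G′ → y ∉ˢ proj₁ p → Admissible G p → Admissible G′ p
  admissible-delete {G} {G′} {y} {A , B} G↭ y∉A (admissible dis A⊆ ∣A∣ ∣B∣) =
    admissible dis A⊆′ (shrink A ∣A∣) (shrink B ∣B∣)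
    where
    shrink : ∀ S {c} → ∣ S ↾ G ∣ ≤ c → ∣ S ↾ G′ ∣ ≤ c
    shrink S ≤c = ≤-trans (≤-trans (count-∷-≤ (_∈ˢ? S) y G′) (≤-reflexive (sym (count-↭ (_∈ˢ? S) G↭)))) ≤c

    A⊆′ : ∀ {x} → x ∈ˢ A → x ∈ G′
    A⊆′ x∈A with ∈-resp-↭ G↭ (A⊆ x∈A)
    ... | here refl = contradiction x∈A y∉A
    ... | there x∈  = x∈

  -- The first set of another pair lies in `G`, so the point where it meets B has not been deleted.
  meets⇒0<∣B∣ : ∀ {G q B} → Admissible G q → Nonempty (proj₁ q ∩ B) → 0 < ∣ B ↾ G ∣
  meets⇒0<∣B∣ {q = A , _} {B} adm (x , x∈) with x∈p∩q⁻ A B x∈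
  ... | x∈A , x∈B = ∈⇒0<count (_∈ˢ? B) (A⊆G adm x∈A) x∈B

  -- Induction on the size of `G`: with at least two pairs, the total weight does not decrease on
  -- average over all one-point deletions, and the survivors of each deletion form a crossing system
  -- on a smaller ground set.
  total-weight : ∀ m G L → length G ≡ m → All (Admissible G) L → AllPairs Cross L →
                 ∑ (λ p → weight ∣ proj₂ p ↾ G ∣) L ≤ weight 0
  total-weight _ G [] _ _ _ = z≤n
  -- A single pair may have B disjoint from `G`, where averaging fails; its weight is bounded
  -- directly.
  total-weight _ G ((A , B) ∷ []) _ (adm ∷ []) _ = ≤-trans (≤-reflexive (+-identityʳ _)) (weight-≤ ∣ B ↾ G ∣ (∣B∣≤b adm))
  -- Two crossing pairs force a point in `G`; in the case after this one `length G` is nonzero and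
  -- can be cancelled.
  total-weight zero [] (_ ∷ _ ∷ _) _ (_ ∷ adm ∷ _) ((cross ∷ _) ∷ _) =
    contradiction (meets⇒0<∣B∣ adm (proj₂ cross)) (λ ())
  total-weight (suc m) G@(_ ∷ _) L@(p ∷ q ∷ _) ∣G∣≡ adms@(admₚ ∷ adm-q ∷ _) cross@((c ∷ cs) ∷ _) =
    *-cancelˡ-≤ (length G) (begin
      length G * ∑ (λ p → weight ∣ proj₂ p ↾ G ∣) L        ≡⟨ ∑-*ˡ (length G) (λ p → weight ∣ proj₂ p ↾ G ∣) L ⟨
      ∑ (λ p → length G * weight ∣ proj₂ p ↾ G ∣) L        ≤⟨ ∑-mono (All.zipWith (λ (adm , pos) → deletion-average adm pos) (adms , positive)) ⟩
      ∑ (λ p → ∑ (termAt p) (deletions G)) L               ≡⟨ ∑-swap termAt L (deletions G) ⟩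
      ∑ (λ d → ∑ (λ p → termAt p d) L) (deletions G)       ≤⟨ ∑-mono (All.map after-deletion (deletions-↭ G)) ⟩
      ∑ (λ _ → weight 0) (deletions G)                     ≡⟨ ∑-const (weight 0) (deletions G) ⟩
      length (deletions G) * weight 0                      ≡⟨ cong (_* weight 0) (length-deletions G) ⟩
      length G * weight 0                                  ∎)
    where
    open ≤-Reasoning

    -- The second entry is the partner that the head meets; the head is the partner of all the
    -- others.
    positive : All (λ p → 0 < ∣ proj₂ p ↾ G ∣) L
    positive = meets⇒0<∣B∣ adm-q (proj₂ c) ∷ All.map (λ c → meets⇒0<∣B∣ admₚ (proj₁ c)) (c ∷ cs)

    after-deletion : ∀ {d} → G ↭ proj₁ d ∷ proj₂ d → ∑ (λ p → termAt p d) L ≤ weight 0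
    after-deletion {y , G′} G↭ = ≤-trans
      (≤-reflexive (sym (∑-filter y∈A? (λ p → weight ∣ proj₂ p ↾ G′ ∣) L)))
      (total-weight m G′ (filter (¬? ∘ y∈A?) L) (suc-injective (≡.trans (sym (↭-length G↭)) ∣G∣≡))
        (All.zipWith (λ (y∉A , adm) → admissible-delete G↭ y∉A adm)
          (All.all-filter (¬? ∘ y∈A?) L , All.filter⁺ (¬? ∘ y∈A?) adms))
        (AllPairs.filter⁺ (¬? ∘ y∈A?) cross))
      where
      y∈A? : Decidable (λ (p : Pair) → y ∈ˢ proj₁ p)
      y∈A? p = y ∈ˢ? proj₁ p

-- `P` and `f` are general because the induction replaces `f` by `f ∘ suc` and S by its tail.
count-tabulate : ∀ {n} {P : Pred A 0ℓ} (P? : Decidable P) (f : Fin n → A) (S : Subset n) →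
                 (∀ i → P (f i) → i ∈ˢ S) → (∀ i → i ∈ˢ S → P (f i)) → count P? (tabulate f) ≡ ∣ S ∣
count-tabulate P? f []      to from = refl
count-tabulate P? f (s ∷ S) to from with count-tabulate P? (f ∘ suc) S (λ i → drop-there ∘ to (suc i)) (λ i → from (suc i) ∘ Vec.there)
count-tabulate P? f (inside  ∷ S) to from | ih = ≡.trans (count-head P? (from zero Vec.here)) (cong suc ih)
count-tabulate P? f (outside ∷ S) to from | ih = ≡.trans (count-tail P? (λ P0 → contradiction (to zero P0) (λ ()))) ih

count-allFin : ∀ {n} (S : Subset n) → count (_∈ˢ? S) (allFin n) ≡ ∣ S ∣
count-allFin S = count-tabulate (_∈ˢ? S) (λ i → i) S (λ _ i∈ → i∈) (λ _ i∈ → i∈)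

-- On the full ground set every pair has weight `weight b`, which is b!, and the total is at most
-- `weight 0`, which is (a + b)! / a!.
bollobás : ∀ {n} a b (L : List (Subset n × Subset n)) →
           All (λ (A , B) → Empty (A ∩ B) × ∣ A ∣ ≡ a × ∣ B ∣ ≡ b) L →
           AllPairs (λ (A , B) (C , D) → Nonempty (A ∩ D) × Nonempty (C ∩ B)) L →
           length L ≤ (a + b) C a
bollobás {n} a b L sizes cross = *-cancelʳ-≤ _ _ (a ! * b !) {{a !* b !≢0}} (begin
  length L * (a ! * b !)                      ≡⟨ lemma (length L) (a !) (b !) ⟩
  a ! * (length L * b !)                      ≤⟨ *-monoʳ-≤ (a !) (begin
    length L * b !                              ≡⟨ ∑-const (b !) L ⟨
    ∑ (λ _ → b !) L                             ≤⟨ ∑-mono (All.map full-weight sizes) ⟩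
    ∑ (λ p → weight ∣ proj₂ p ↾ allFin n ∣) L   ≤⟨ total-weight _ (allFin n) L refl (All.map adm sizes) cross ⟩
    weight 0                                    ≡⟨ *-identityˡ _ ⟩
    rising (a + 0) b                            ≡⟨ cong (λ k → rising k b) (+-identityʳ a) ⟩
    rising a b                                  ∎) ⟩
  a ! * rising a b                            ≡⟨ !*rising a b ⟩
  (a + b) !                                   ≡⟨ C*!*! a b ⟨
  ((a + b) C a) * (a ! * b !)                 ∎)
  where
  open ≤-Reasoning
  open SetPairs a b n

  lemma : ∀ l x y → l * (x * y) ≡ x * (l * y)
  lemma = solve-∀

  full-weight : ∀ {p} → Empty (proj₁ p ∩ proj₂ p) × ∣ proj₁ p ∣ ≡ a × ∣ proj₂ p ∣ ≡ b → b ! ≤ weight ∣ proj₂ p ↾ allFin n ∣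
  full-weight {A , B} (_ , _ , refl) rewrite count-allFin B | n∸n≡0 ∣ B ∣ = ≤-reflexive (sym (*-identityʳ _))

  adm : ∀ {p} → Empty (proj₁ p ∩ proj₂ p) × ∣ proj₁ p ∣ ≡ a × ∣ proj₂ p ∣ ≡ b → Admissible (allFin n) p
  adm {A , B} (dis , ∣A∣ , ∣B∣) = admissible dis (λ _ → ∈-allFin _)
    (≤-reflexive (≡.trans (count-allFin A) ∣A∣)) (≤-reflexive (≡.trans (count-allFin B) ∣B∣))

-- Induced matchings and edge counts in a finite graph.

module Graph {V : Set} {_~_ : V → V → Set} (_~?_ : Decidable₂ _~_) (~-sym : Symmetric _~_) where

  edges : List V → ℕ
  edges []       = 0
  edges (x ∷ xs) = count (x ~?_) xs + edges xs

  edges-swap : ∀ x y zs → edges (x ∷ y ∷ zs) ≡ edges (y ∷ x ∷ zs)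
  edges-swap x y zs with x ~? y | y ~? x
  ... | yes _   | yes _   = cong suc (x∙yz≈y∙xz +-commutativeSemigroup (count (x ~?_) zs) (count (y ~?_) zs) (edges zs))
  ... | no _    | no _    = x∙yz≈y∙xz +-commutativeSemigroup (count (x ~?_) zs) (count (y ~?_) zs) (edges zs)
  ... | yes x~y | no ¬y~x = contradiction (~-sym x~y) ¬y~x
  ... | no ¬x~y | yes y~x = contradiction (~-sym y~x) ¬x~y

  -- By symmetry of adjacency the order of the list is immaterial, so a vertex of large degree can
  -- be moved to the head and split off.
  edges-↭ : ∀ {xs ys} → xs ↭ ys → edges xs ≡ edges ys
  edges-↭ refl            = refl
  edges-↭ (prep x p)      = cong₂ _+_ (count-↭ (x ~?_) p) (edges-↭ p)
  edges-↭ (swap {xs} x y p) = ≡.trans (edges-swap x y xs)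
    (cong₂ _+_ (count-↭ (y ~?_) (prep x p)) (cong₂ _+_ (count-↭ (x ~?_) p) (edges-↭ p)))
  edges-↭ (trans p q)     = ≡.trans (edges-↭ p) (edges-↭ q)

  Independent : List V → Set
  Independent xs = ∀ {x y} → x ∈ xs → y ∈ xs → ¬ x ~ y

  -- Every edge of the matching is listed in both orientations.
  record InducedMatching (xs : List V) (L : List (V × V)) : Set where
    constructor matching
    field
      inside-xs : All (λ (x , y) → x ∈ xs × y ∈ xs) L
      edge      : All (λ (x , y) → x ~ y) L
      induced   : AllPairs (λ (x , y) (z , w) → ¬ x ~ w × ¬ z ~ y) L

  find-edge : ∀ xs → Independent xs ⊎ (∃[ x ] ∃[ y ] x ∈ xs × y ∈ xs × x ~ y)
  find-edge xs with any? (λ x → any? (x ~?_) xs) xs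
  ... | no ¬edge = inj₁ λ x∈ y∈ x~y → ¬edge (lose x∈ (lose y∈ x~y))
  ... | yes edge with find edge
  ...   | x , x∈ , edge-at-x with find edge-at-x
  ...     | y , y∈ , x~y = inj₂ (x , y , x∈ , y∈ , x~y)

  -- In a maximal induced matching the neighbourhoods of the matched vertices cover every edge.
  matching-cover : ∀ m xs → length xs ≤ m → Unique xs → All (λ x → ¬ x ~ x) xs →
    ∃[ L ] ∃[ ys ] InducedMatching xs L × Unique ys × ys ⊆ xs × Independent ys ×
                   length xs ≤ length ys + ∑ (λ p → count (proj₁ p ~?_) xs) L
  matching-cover m xs ≤m uxs irr with find-edge xs
  ... | inj₁ ind = [] , xs , matching [] [] [] , uxs , (λ x∈ → x∈) , ind , m≤m+n (length xs) 0
  matching-cover zero    []  ≤m uxs irr | inj₂ (_ , _ , () , _)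
  matching-cover (suc m) xs ≤m uxs irr | inj₂ (x , y , x∈ , y∈ , x~y)
    with matching-cover m (filter (¬? ∘ (y ~?_)) (filter (¬? ∘ (x ~?_)) xs)) xs₂≤m
           (AllPairs.filter⁺ _ (AllPairs.filter⁺ _ uxs)) (All.filter⁺ _ (All.filter⁺ _ irr))
    where
    -- `y` is a neighbour of `x`, so removing the neighbours of `x` already shortens the list.
    xs₂≤m : length (filter (¬? ∘ (y ~?_)) (filter (¬? ∘ (x ~?_)) xs)) ≤ m
    xs₂≤m = ≤-pred (≤-trans (s≤s (length-filter (¬? ∘ (y ~?_)) (filter (¬? ∘ (x ~?_)) xs)))
                   (≤-trans (filter-notAll (¬? ∘ (x ~?_)) xs (lose y∈ (λ ¬x~y → ¬x~y x~y))) ≤m))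
  ... | L , ys , matching L⊆ edge induced , uys , ys⊆ , ind , bound =
    (x , y) ∷ (y , x) ∷ L , ys
    , matching ((x∈ , y∈) ∷ (y∈ , x∈) ∷ All.map (λ (z∈ , w∈) → proj₁ (∈xs₂ z∈) , proj₁ (∈xs₂ w∈)) L⊆)
               (x~y ∷ ~-sym x~y ∷ edge)
               -- Between the two orientations of one edge, inducedness says that `x` and `y` carry
               -- no loop; later edges avoid the neighbours of both.
               ((((All.lookup irr x∈) , (All.lookup irr y∈)) ∷ All.map crossˣ L⊆) ∷ All.map crossʸ L⊆ ∷ induced)
    , uys , proj₁ ∘ ∈xs₂ ∘ ys⊆ , ind , bound′
    where
    xs₁ = filter (¬? ∘ (x ~?_)) xs
    xs₂ = filter (¬? ∘ (y ~?_)) xs₁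
    deg = λ v → count (v ~?_) xs

    ∈xs₂ : ∀ {z} → z ∈ xs₂ → z ∈ xs × ¬ x ~ z × ¬ y ~ z
    ∈xs₂ z∈ with ∈-filter⁻ (¬? ∘ (y ~?_)) {xs = xs₁} z∈
    ... | z∈₁ , ¬y~z with ∈-filter⁻ (¬? ∘ (x ~?_)) {xs = xs} z∈₁
    ...   | z∈₀ , ¬x~z = z∈₀ , ¬x~z , ¬y~z

    crossˣ : ∀ {p} → proj₁ p ∈ xs₂ × proj₂ p ∈ xs₂ → ¬ x ~ proj₂ p × ¬ proj₁ p ~ y
    crossˣ (z∈ , w∈) = proj₁ (proj₂ (∈xs₂ w∈)) , proj₂ (proj₂ (∈xs₂ z∈)) ∘ ~-sym

    crossʸ : ∀ {p} → proj₁ p ∈ xs₂ × proj₂ p ∈ xs₂ → ¬ y ~ proj₂ p × ¬ proj₁ p ~ x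
    crossʸ (z∈ , w∈) = proj₂ (proj₂ (∈xs₂ w∈)) , proj₁ (proj₂ (∈xs₂ z∈)) ∘ ~-sym

    -- Each orientation is charged with the degree of its first vertex, so `(x , y)` and `(y , x)`
    -- together pay for all removed neighbours.
    bound′ : length xs ≤ length ys + (deg x + (deg y + ∑ (deg ∘ proj₁) L))
    bound′ = begin
      length xs                                                      ≡⟨ count-∁ (x ~?_) xs ⟩
      length xs₁ + deg x                                             ≡⟨ cong (_+ deg x) (count-∁ (y ~?_) xs₁) ⟩
      length xs₂ + count (y ~?_) xs₁ + deg x
        ≤⟨ +-monoˡ-≤ (deg x) (+-mono-≤ bound (count-filter-≤ (y ~?_) (¬? ∘ (x ~?_)) xs)) ⟩
      length ys + ∑ (λ p → count (proj₁ p ~?_) xs₂) L + deg y + deg x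
        ≤⟨ +-monoˡ-≤ (deg x) (+-monoˡ-≤ (deg y) (+-monoʳ-≤ (length ys) (∑-mono (All.universal shrink L)))) ⟩
      length ys + ∑ (deg ∘ proj₁) L + deg y + deg x                  ≡⟨ lemma (length ys) (∑ (deg ∘ proj₁) L) (deg y) (deg x) ⟩
      length ys + (deg x + (deg y + ∑ (deg ∘ proj₁) L))              ∎
      where
      open ≤-Reasoning
      shrink : ∀ p → count (proj₁ p ~?_) xs₂ ≤ deg (proj₁ p)
      shrink (v , _) = ≤-trans (count-filter-≤ (v ~?_) (¬? ∘ (y ~?_)) xs₁) (count-filter-≤ (v ~?_) (¬? ∘ (x ~?_)) xs)
      lemma : ∀ a b c d → a + b + c + d ≡ a + (d + (c + b))
      lemma = solve-∀

  -- Some vertex has degree at least (k + 1) / N, and deleting it lowers k by at most one.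
  quadratic-edges : ∀ N .{{_ : NonZero N}} k xs → Unique xs → All (λ x → ¬ x ~ x) xs →
    (∀ L → InducedMatching xs L → length L ≤ N) →
    (∀ ys → Unique ys → ys ⊆ xs → Independent ys → length ys + k ≤ length xs) →
    k * suc k ≤ 2 * (N * edges xs)
  quadratic-edges N zero    xs uxs irr few-edges no-large = z≤n
  quadratic-edges N (suc k) xs uxs irr few-edges no-large
    with any? (λ v → suc k ≤? N * count (v ~?_) xs) xs
  ... | no ¬large =
    -- Here N · deg ≤ k at every vertex. The at most N entries of `L` then have total degree at most
    -- k, so `ys` omits at most k vertices, against `no-large`.
    let L , ys , match , uys , ys⊆ , ind , bound = matching-cover (length xs) xs ≤-refl uxs irr
        deg = λ (p : V × V) → count (proj₁ p ~?_) xs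
        open ≤-Reasoning
        deg≤ : All (λ p → N * deg p ≤ k) L
        deg≤ = All.map (λ (x∈ , _) → ≤-pred (≰⇒> (λ large → ¬large (lose x∈ large)))) (InducedMatching.inside-xs match)
        ∑deg≤k : ∑ deg L ≤ k
        ∑deg≤k = *-cancelˡ-≤ N (begin
          N * ∑ deg L               ≡⟨ ∑-*ˡ N deg L ⟨
          ∑ (λ p → N * deg p) L     ≤⟨ ∑-mono deg≤ ⟩
          ∑ (λ _ → k) L             ≡⟨ ∑-const k L ⟩
          length L * k              ≤⟨ *-monoˡ-≤ k (few-edges L match) ⟩
          N * k                     ∎)
    in contradiction (begin-strict
         length xs                ≤⟨ bound ⟩
         length ys + ∑ deg L      ≤⟨ +-monoʳ-≤ (length ys) ∑deg≤k ⟩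
         length ys + k            <⟨ +-monoʳ-< (length ys) (n<1+n k) ⟩
         length ys + suc k        ≤⟨ no-large ys uys ys⊆ ind ⟩
         length xs                ∎) (<-irrefl refl)
  ... | yes large with find large
  ...   | v , v∈ , large-v with ∈⇒↭ v∈
  ...     | xs′ , xs↭ with ↭ₛ.Unique-resp-↭ (≡.setoid V) (↭⇒↭ₛ xs↭) uxs | All-resp-↭ xs↭ irr
  ...       | _ ∷ uxs′ | irr-v ∷ irr′ = begin
    -- Consecutive values of k (k + 1) differ by 2 (k + 1), which is covered by twice N · deg `v`.
    suc k * suc (suc k)                          ≡⟨ lemma k ⟩
    k * suc k + 2 * suc k                        ≤⟨ +-mono-≤ IH (*-monoʳ-≤ 2 large-v) ⟩
    2 * (N * edges xs′) + 2 * (N * count (v ~?_) xs) ≡⟨ cong (λ d → 2 * (N * edges xs′) + 2 * (N * d)) deg-v ⟩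
    2 * (N * edges xs′) + 2 * (N * count (v ~?_) xs′) ≡⟨ lemma′ N (edges xs′) _ ⟩
    2 * (N * edges (v ∷ xs′))                    ≡⟨ cong (λ c → 2 * (N * c)) (edges-↭ xs↭) ⟨
    2 * (N * edges xs)                           ∎
    where
    open ≤-Reasoning
    lemma : ∀ k → suc k * suc (suc k) ≡ k * suc k + 2 * suc k
    lemma = solve-∀
    lemma′ : ∀ n e d → 2 * (n * e) + 2 * (n * d) ≡ 2 * (n * (d + e))
    lemma′ = solve-∀

    deg-v : count (v ~?_) xs ≡ count (v ~?_) xs′
    deg-v = ≡.trans (count-↭ (v ~?_) xs↭) (count-tail (v ~?_) irr-v)

    lift : xs′ ⊆ xs
    lift = ∈-resp-↭ (↭-sym xs↭) ∘ there

    IH : k * suc k ≤ 2 * (N * edges xs′)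
    IH = quadratic-edges N k xs′ uxs′ irr′
      (λ L (matching L⊆ edge ind) → few-edges L (matching (All.map (λ (x∈ , y∈) → lift x∈ , lift y∈) L⊆) edge ind))
      -- Passing to `xs′` lowers the length by one, hence k + 1 to k.
      (λ ys uys ys⊆ ind → ≤-pred (begin
        suc (length ys + k)   ≡⟨ +-suc (length ys) k ⟨
        length ys + suc k     ≤⟨ no-large ys uys (lift ∘ ys⊆) ind ⟩
        length xs             ≡⟨ ↭-length xs↭ ⟩
        suc (length xs′)      ∎))

-- Application to the Kneser graph.

∣S∣≡0⇒Empty : ∀ {n} {S : Subset n} → ∣ S ∣ ≡ 0 → Empty S
∣S∣≡0⇒Empty {S = S} ∣S∣≡0 (x , x∈S) = contradiction (begin
  1           ≡⟨ ∣⁅x⁆∣≡1 x ⟨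
  ∣ ⁅ x ⁆ ∣   ≤⟨ p⊆q⇒∣p∣≤∣q∣ (λ y∈ → subst (_∈ˢ S) (sym (x∈⁅y⁆⇒x≡y _ y∈)) x∈S) ⟩
  ∣ S ∣       ≡⟨ ∣S∣≡0 ⟩
  0           ∎) (λ ())
  where open ≤-Reasoning

-- Makes the graph loopless for r ≥ 1; the empty set is disjoint from itself.
¬disjoint-self : ∀ {n r} {S : Subset n} → ∣ S ∣ ≡ suc r → ¬ Disjoint (S , S)
¬disjoint-self {n} {S = S} ∣S∣ dis = contradiction
  (≡.trans (sym ∣S∣) (≡.trans (cong ∣_∣ (Empty-unique {p = S} λ (x , x∈) → dis (x , x∈p∩q⁺ (x∈ , x∈)))) (∣⊥∣≡0 n)))
  (λ ())

¬disjoint⇒nonempty : ∀ {n} (S T : Subset n) → ¬ Disjoint (S , T) → Nonempty (S ∩ T)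
¬disjoint⇒nonempty S T = decidable-stable (nonempty? (S ∩ T))

module Kneser {n : ℕ} = Graph {Subset n} (λ S T → disjoint? (S , T)) (λ {S} {T} dis → subst Empty (∩-comm S T) dis)

e≡edges : ∀ {n} (xs : List (Subset n)) → count disjoint? (pairs xs) ≡ Kneser.edges xs
e≡edges []       = refl
e≡edges (x ∷ xs) = begin
  length (filter disjoint? (map (x ,_) xs ++ pairs xs))         ≡⟨ cong length (filter-++ disjoint? (map (x ,_) xs) (pairs xs)) ⟩
  length (filter disjoint? (map (x ,_) xs) ++ filter disjoint? (pairs xs)) ≡⟨ length-++ (filter disjoint? (map (x ,_) xs)) ⟩
  count disjoint? (map (x ,_) xs) + count disjoint? (pairs xs)  ≡⟨ cong₂ _+_ (count-map disjoint? (x ,_) xs) (e≡edges xs) ⟩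
  Kneser.edges (x ∷ xs)                                         ∎
  where open ≡-Reasoning

-- Maximality of the chosen subfamily turns every intersecting subfamily into an upper bound for ℓ;
-- `no-large` below is the additive form.
ℓ≤ : ∀ {n r} (𝓐 𝓑 : Family n r) → 𝓑 ⊆ᶠ 𝓐 → Intersecting 𝓑 → ℓ 𝓐 ≤ card 𝓐 ∸ card 𝓑
ℓ≤ 𝓐 𝓑 𝓑⊆𝓐 int = ∸-monoʳ-≤ (card 𝓐) (IsMaximumIntersecting.maximum (proj₂ (maximumIntersecting 𝓐)) 𝓑 𝓑⊆𝓐 int)

ℓ²≤2Ce : ∀ n r (𝓐 : Family n r) → ℓ 𝓐 ^ 2 ≤ e 𝓐 * (2 * ((2 * r) C r))
-- For r = 0 the empty set has a loop and the graph argument fails, but all members coincide, so the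
-- family is intersecting and ℓ is 0. The binomial coefficient computes to 1, hence the factor 2.
ℓ²≤2Ce n zero 𝓐 = subst (λ k → k ^ 2 ≤ e 𝓐 * 2) (sym ℓ≡0) z≤n
  where
  all-equal : Intersecting 𝓐
  all-equal S∈ T∈ S≢T = contradiction (≡.trans (is-⊥ S∈) (sym (is-⊥ T∈))) S≢T
    where
    is-⊥ : ∀ {S} → S ∈ members 𝓐 → S ≡ _
    is-⊥ S∈ = Empty-unique (∣S∣≡0⇒Empty (All.lookup (uniform 𝓐) S∈))
  ℓ≡0 : ℓ 𝓐 ≡ 0
  ℓ≡0 = n≤0⇒n≡0 (subst (ℓ 𝓐 ≤_) (n∸n≡0 (card 𝓐)) (ℓ≤ 𝓐 𝓐 (λ S∈ → S∈) all-equal))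
ℓ²≤2Ce n r@(suc _) 𝓐 = begin
  ℓ 𝓐 ^ 2                       ≡⟨ cong (ℓ 𝓐 *_) (*-identityʳ (ℓ 𝓐)) ⟩
  ℓ 𝓐 * ℓ 𝓐                     ≤⟨ *-monoʳ-≤ (ℓ 𝓐) (n≤1+n (ℓ 𝓐)) ⟩
  ℓ 𝓐 * suc (ℓ 𝓐)               ≤⟨ Kneser.quadratic-edges N {{>-nonZero (nCk>0 (m≤m+n r (r + 0)))}} (ℓ 𝓐) (members 𝓐) (unique 𝓐)
                                      (All.map ¬disjoint-self (uniform 𝓐)) few-edges no-large ⟩
  2 * (N * Kneser.edges (members 𝓐)) ≡⟨ cong (λ k → 2 * (N * k)) (e≡edges (members 𝓐)) ⟨
  2 * (N * e 𝓐)                 ≡⟨ *-assoc 2 N (e 𝓐) ⟨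
  2 * N * e 𝓐                   ≡⟨ *-comm (2 * N) (e 𝓐) ⟩
  e 𝓐 * (2 * N)                 ∎
  where
  open ≤-Reasoning
  N = (2 * r) C r

  few-edges : ∀ L → Kneser.InducedMatching (members 𝓐) L → length L ≤ N
  -- `2 * r` unfolds to `r + (r + 0)`, hence the transport. Non-adjacent sets meet, so inducedness
  -- is the crossing condition.
  few-edges L (Kneser.matching L⊆ edge induced) = subst (λ k → length L ≤ (r + k) C r) (sym (+-identityʳ r))
    (bollobás r r L
      (All.zipWith (λ ((S∈ , T∈) , dis) → dis , All.lookup (uniform 𝓐) S∈ , All.lookup (uniform 𝓐) T∈) (L⊆ , edge))
      (AllPairs.map (λ {p} {q} (¬dis , ¬dis′) → ¬disjoint⇒nonempty (proj₁ p) (proj₂ q) ¬dis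
                                              , ¬disjoint⇒nonempty (proj₁ q) (proj₂ p) ¬dis′) induced))

  no-large : ∀ ys → Unique ys → ys ⊆ members 𝓐 → Kneser.Independent ys → length ys + ℓ 𝓐 ≤ card 𝓐
  no-large ys uys ys⊆ ind = begin
    length ys + ℓ 𝓐                       ≤⟨ +-monoʳ-≤ (length ys) (ℓ≤ 𝓐 𝓑 ys⊆ λ S∈ T∈ _ → ¬disjoint⇒nonempty _ _ (ind S∈ T∈)) ⟩
    -- `ys` is no longer than `members 𝓐`, so truncation loses nothing.
    length ys + (card 𝓐 ∸ length ys)      ≡⟨ m+[n∸m]≡n (unique-⊆⇒length-≤ uys ys⊆) ⟩
    card 𝓐                                ∎
    where
    𝓑 : Family n r
    𝓑 = record { members = ys ; unique = uys ; uniform = All.tabulate λ S∈ → All.lookup (uniform 𝓐) (ys⊆ S∈) }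

-- Opened only here: with +_ in scope, sections such as (c +_) no longer parse.
open import Data.Integer using (+_)

-- Transfer to the rationals.

/-≤-/1 : ∀ x y d .{{_ : NonZero d}} → x ≤ y * d → (+ x) / d ℚ.≤ (+ y) / 1
-- Unnormalised fractions compare by cross-multiplication. Matching `d` with a successor makes
-- `(+ x) / d` the image of the unnormalised fraction under `fromℚᵘ`.
/-≤-/1 x y d@(suc _) x≤yd = ℚ.toℚᵘ-cancel-≤ (begin
  ℚ.toℚᵘ ((+ x) / d)   ≃⟨ ℚ.toℚᵘ-fromℚᵘ ((+ x) ℚᵘ./ d) ⟩
  (+ x) ℚᵘ./ d         ≤⟨ ℚᵘ.*≤* (ℤ.≤-trans (ℤ.≤-reflexive (ℤ.*-identityʳ (+ x)))
                            (ℤ.≤-trans (ℤ.+≤+ x≤yd) (ℤ.≤-reflexive (ℤ.pos-* y d)))) ⟩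
  (+ y) ℚᵘ./ 1         ≃⟨ ℚ.toℚᵘ-fromℚᵘ ((+ y) ℚᵘ./ 1) ⟨
  ℚ.toℚᵘ ((+ y) / 1)   ∎)
  where open ℚᵘ.≤-Reasoning

lemma3p1 : (n r : ℕ) (𝓐 : Family n r) →
    (+ e 𝓐) / 1 ≥ ((+ (ℓ 𝓐 ^ 2)) / (2 * ((2 * r) C r))) {{2*[2r]Cr≢0 r}}
lemma3p1 n r 𝓐 = /-≤-/1 (ℓ 𝓐 ^ 2) (e 𝓐) (2 * ((2 * r) C r)) {{2*[2r]Cr≢0 r}} (ℓ²≤2Ce n r 𝓐)
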